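{- For every $\epsilon>0$ there exists a family of instances of maximizing a monotone submodular (in fact coverage) function under cardinality constraint $k$ with the following property. Suppose each item is sent to at least one and at most $C\le\sqrt{\epsilon m/2}$ machines chosen uniformly at random among $m$ machines, and the algorithm on each machine may return at most $k$ items. If the per-machine algorithm is $\mathsf{Greedy}$ or any local search algorithm, then it is at most a $(\frac12+\frac1k+\epsilon)$-approximate composable core-set; that is, $\mathbb E[f_k(\bigcup_{i=1}^m\mathsf{ALG}(T_i))]\le(\frac12+\frac1k+\epsilon)\max_{|S|\le k}f(S)$, where $T_i$ is the set of items sent to machine $i$.
   Context: For a finite ground set $\mathbb N$ and $f:2^{\mathbb N}\to\mathbb R_{\ge0}$, $f_k(S)=\max_{S'\subseteq S,|S'|\le k}f(S')$. A coverage function: items are subsets of a universe $\mathbb U$ and $f(S)=|\bigcup_{A\in S}A|$. $\mathsf{Greedy}$ on a set $T$ starts from $\emptyset$ and repeatedly adds an item of maximum marginal value $f(S\cup\{x\})-f(S)$, returning at most $k$ items. A local search algorithm here means an algorithm returning a locally optimum solution of size at most $k$ (one that cannot be improved by exchanging a selected item for an unselected one). -}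

module Defs where

open import Data.Bool using (Bool; true; false; _∧_; if_then_else_)
open import Data.Nat using (ℕ; zero; suc; _+_; _*_; _∸_; _≤_; _<_; _⊔_; _≤ᵇ_; _≡ᵇ_)
open import Data.Fin using (Fin)
import Data.Fin
open import Data.Fin.Subset using (Subset; ⊥; ⊤; ⁅_⁆; _∈_; _∉_; _⊆_; _∪_; _-_; ⋃; ∣_∣)
open import Data.List using (List; []; _∷_; map; filterᵇ; foldr; concatMap; length)
open import Data.Nat.ListAction using (sum)
open import Data.Vec using (Vec; []; _∷_; lookup; tabulate; toList)
open import Data.Product using (_×_)
open import Data.Sum using (_⊎_)
open import Relation.Binary.PropositionalEquality using (_≡_)

-- Coverage instances.
-- Items are Fin n, the universe is Fin u, item x is the set  cover x ⊆ Fin u.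
-- A set of items S is a  Subset n  (characteristic vector).

Cover : ℕ → ℕ → Set
Cover n u = Fin n → Subset u

covered : ∀ {n u} → Cover n u → Subset n → Subset u
covered {n} cv S = ⋃ (toList (tabulate (λ x → if lookup S x then cv x else ⊥)))

cov : ∀ {n u} → Cover n u → Subset n → ℕ
cov cv S = ∣ covered cv S ∣

allSubsets : (n : ℕ) → List (Subset n)
allSubsets zero    = [] ∷ []
allSubsets (suc n) = concatMap (λ s → (false ∷ s) ∷ (true ∷ s) ∷ []) (allSubsets n)

_⊆ᵇ_ : ∀ {n} → Subset n → Subset n → Bool
[]          ⊆ᵇ []          = true
(false ∷ a) ⊆ᵇ (_ ∷ b)     = a ⊆ᵇ b
(true ∷ a)  ⊆ᵇ (true ∷ b)  = a ⊆ᵇ b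
(true ∷ a)  ⊆ᵇ (false ∷ b) = false

maxList : List ℕ → ℕ
maxList = foldr _⊔_ 0

fk : ∀ {n u} → Cover n u → ℕ → Subset n → ℕ
fk {n} cv k S =
  maxList (map (cov cv) (filterᵇ (λ S' → (S' ⊆ᵇ S) ∧ (∣ S' ∣ ≤ᵇ k)) (allSubsets n)))

opt : ∀ {n u} → Cover n u → ℕ → ℕ
opt cv k = fk cv k ⊤

-- Greedy on T with cardinality k, with arbitrary tie-breaking:
-- GreedyFrom cv k T S R  means "the greedy run, currently holding S,
-- can end with output R".  It stops once it holds k items or every item
-- of T has been selected; otherwise it adds an item of T∖S of maximum
-- marginal value f(S ∪ {x}) − f(S).
data GreedyFrom {n u} (cv : Cover n u) (k : ℕ) (T : Subset n) :
       Subset n → Subset n → Set where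
  stop : ∀ {S} → (∣ S ∣ ≡ k ⊎ T ⊆ S) → GreedyFrom cv k T S S
  step : ∀ {S R} (x : Fin n) → ∣ S ∣ < k → x ∈ T → x ∉ S →
         (∀ y → y ∈ T → y ∉ S →
            cov cv (S ∪ ⁅ y ⁆) ∸ cov cv S ≤ cov cv (S ∪ ⁅ x ⁆) ∸ cov cv S) →
         GreedyFrom cv k T (S ∪ ⁅ x ⁆) R → GreedyFrom cv k T S R

IsGreedyOutput : ∀ {n u} → Cover n u → ℕ → Subset n → Subset n → Set
IsGreedyOutput cv k T R = GreedyFrom cv k T ⊥ R

IsLocalOpt : ∀ {n u} → Cover n u → ℕ → Subset n → Subset n → Set
IsLocalOpt cv k T S =
  S ⊆ T × ∣ S ∣ ≤ k ×
  (∀ x y → x ∈ S → y ∈ T → y ∉ S → cov cv ((S - x) ∪ ⁅ y ⁆) ≤ cov cv S)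

-- Random distribution of items to m machines.
-- Item x is sent to a uniformly random set of exactly c x machines
-- (independently over items).  The sample space is the list of all
-- assignments  a : Vec (Subset m) n  with  ∣ lookup a x ∣ = c x,
-- each equally likely.

assignments : ∀ m {n} → (Fin n → ℕ) → List (Vec (Subset m) n)
assignments m {zero}  c = [] ∷ []
assignments m {suc n} c =
  concatMap (λ Mx → map (Mx ∷_) (assignments m (λ i → c (Data.Fin.suc i))))
            (filterᵇ (λ M → ∣ M ∣ ≡ᵇ c Data.Fin.zero) (allSubsets m))

machineInput : ∀ {m n} → Vec (Subset m) n → Fin m → Subset n
machineInput a i = tabulate (λ x → lookup (lookup a x) i)

coreValue : ∀ {m n u} → Cover n u → ℕ → (Subset n → Subset n) →
            Vec (Subset m) n → ℕ
coreValue {m} cv k alg a =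
  fk cv k (⋃ (toList (tabulate (λ i → alg (machineInput a i)))))

-- Sum over the sample space of  f_k(⋃_i ALG(T_i)); the expectation is
-- totalValue / length (assignments m c).
totalValue : ∀ m {n u} → Cover n u → ℕ → (Fin n → ℕ) → (Subset n → Subset n) → ℕ
totalValue m cv k c alg = sum (map (coreValue cv k alg) (assignments m c))

-- E[f_k(⋃ ALG(T_i))] ≤ (1/2 + 1/k + p/q) · OPT, with denominators cleared:
-- E = totalValue / N (N = number of equally likely outcomes), multiplied
-- through by 2·k·q · N.
ExpectationBound : ∀ m {n u} → Cover n u → ℕ → (Fin n → ℕ) →
                   (Subset n → Subset n) → ℕ → ℕ → Set
ExpectationBound m cv k c alg p q =
  2 * k * q * totalValue m cv k c alg
    ≤ (k * q + 2 * q + 2 * k * p) * opt cv k * length (assignments m c)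

{-# OPTIONS --safe #-}

-- The universe consists of k left blocks of k + 1 points and k − 1 right blocks of k
-- points. One big item covers all left blocks, the i-th hidden item covers the i-th right block,
-- and many decoys cover each single left block. The big item and the hidden items together cover
-- all 2k² points. A machine that does not hold the big item but sees decoys of all k types never
-- returns a hidden item, since some unused decoy has marginal value k + 1 against k. So a hidden
-- item survives only if it meets the big item on some machine, which has probability at most
-- C²/m ≤ ε/2, and the left blocks alone are worth k(k + 1) = (1/2 + 1/(2k))·2k². The probability
-- that some decoy type is absent from some machine is made at most 1/(2k) by taking enough copies.
module Submission where

open import Defs
open import Data.Bool using (Bool; true; false; if_then_else_; _∨_; _∧_; T)
open import Data.Bool.Properties using (T-∧)
open import Data.Nat
open import Data.Nat.Properties
open import Data.Nat.ListAction using () renaming (sum to sumˡ)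
open import Data.Nat.ListAction.Properties using (sum-++)
open import Data.Nat.Tactic.RingSolver using (solve-∀)
open import Data.Fin using (Fin; zero; suc; _↑ˡ_; _↑ʳ_; splitAt; remQuot; combine)
import Data.Fin.Properties as Fin
open import Data.Fin.Subset as Subset hiding (_-_)
open import Data.Fin.Subset.Properties
open import Data.List as List using (List; []; _∷_; map; filterᵇ; concatMap; length)
open import Data.List.Properties using (map-++; map-cong; map-∘)
open import Data.List.Membership.Propositional using () renaming (_∈_ to _∈ˡ_)
open import Data.List.Membership.Propositional.Properties using (∈-map⁺; ∈-filter⁺; ∈-concatMap⁺)
open import Data.List.Relation.Unary.Any as Any using (here; there)
open import Data.Vec as Vec using (Vec; []; _∷_; lookup; tabulate; toList)
open import Data.Vec.Properties using (zipWith-replicate; zipWith-++; []=⇒lookup; lookup⇒[]=; lookup∘tabulate)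
open import Data.Product using (Σ; ∃; _×_; _,_; proj₁; proj₂)
open import Data.Sum using (_⊎_; inj₁; inj₂; [_,_]′)
open import Function using (_∘_; const; Equivalence)
open import Relation.Nullary using (contradiction; yes; no)
open import Relation.Binary.PropositionalEquality
open import Algebra.Properties.Semiring.Sum +-*-semiring using () renaming (sum to ∑)

private variable
  A B : Set
  m n u : ℕ

-- Sums over lists and over finite index sets.

sumOver : (A → ℕ) → List A → ℕ
sumOver f xs = sumˡ (map f xs)

sumOver-cong : {f g : A → ℕ} → f ≗ g → sumOver f ≗ sumOver g
sumOver-cong f≗g xs = cong sumˡ (map-cong f≗g xs)

sumOver-map : (f : B → ℕ) (g : A → B) (xs : List A) → sumOver f (map g xs) ≡ sumOver (f ∘ g) xs
sumOver-map f g xs = cong sumˡ (sym (map-∘ xs))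

sumOver-concatMap : (f : B → ℕ) (g : A → List B) (xs : List A) →
                    sumOver f (concatMap g xs) ≡ sumOver (sumOver f ∘ g) xs
sumOver-concatMap f g []       = refl
sumOver-concatMap f g (x ∷ xs) = begin
  sumˡ (map f (g x List.++ concatMap g xs))            ≡⟨ cong sumˡ (map-++ f (g x) (concatMap g xs)) ⟩
  sumˡ (map f (g x) List.++ map f (concatMap g xs))    ≡⟨ sum-++ (map f (g x)) _ ⟩
  sumOver f (g x) + sumOver f (concatMap g xs)         ≡⟨ cong (sumOver f (g x) +_) (sumOver-concatMap f g xs) ⟩
  sumOver f (g x) + sumOver (sumOver f ∘ g) xs         ∎
  where open ≡-Reasoning

sumOver-mono : {f g : A → ℕ} → (∀ x → f x ≤ g x) → ∀ xs → sumOver f xs ≤ sumOver g xs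
sumOver-mono f≤g []       = z≤n
sumOver-mono f≤g (x ∷ xs) = +-mono-≤ (f≤g x) (sumOver-mono f≤g xs)

sumOver-+ : (f g : A → ℕ) (xs : List A) →
            sumOver (λ x → f x + g x) xs ≡ sumOver f xs + sumOver g xs
sumOver-+ f g []       = refl
sumOver-+ f g (x ∷ xs) rewrite sumOver-+ f g xs = interchange (f x) (g x) (sumOver f xs) (sumOver g xs)
  where
  interchange : ∀ a b c d → a + b + (c + d) ≡ a + c + (b + d)
  interchange = solve-∀

sumOver-*ˡ : (a : ℕ) (f : A → ℕ) (xs : List A) → sumOver (λ x → a * f x) xs ≡ a * sumOver f xs
sumOver-*ˡ a f []       = sym (*-zeroʳ a)
sumOver-*ˡ a f (x ∷ xs) rewrite sumOver-*ˡ a f xs = sym (*-distribˡ-+ a (f x) _)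

sumOver-*ʳ : (f : A → ℕ) (b : ℕ) (xs : List A) → sumOver (λ x → f x * b) xs ≡ sumOver f xs * b
sumOver-*ʳ f b xs = begin
  sumOver (λ x → f x * b) xs ≡⟨ sumOver-cong (λ x → *-comm (f x) b) xs ⟩
  sumOver (λ x → b * f x) xs ≡⟨ sumOver-*ˡ b f xs ⟩
  b * sumOver f xs           ≡⟨ *-comm b _ ⟩
  sumOver f xs * b           ∎
  where open ≡-Reasoning

sumOver-const : (a : ℕ) (xs : List A) → sumOver (const a) xs ≡ length xs * a
sumOver-const a []       = refl
sumOver-const a (x ∷ xs) = cong (a +_) (sumOver-const a xs)

sumOver-1 : (xs : List A) → sumOver (const 1) xs ≡ length xs
sumOver-1 xs = trans (sumOver-const 1 xs) (*-identityʳ _)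

sumOver-filterᵇ : (P : A → Bool) (f : A → ℕ) (xs : List A) →
                  sumOver f (filterᵇ P xs) ≡ sumOver (λ x → if P x then f x else 0) xs
sumOver-filterᵇ P f []       = refl
sumOver-filterᵇ P f (x ∷ xs) with P x
... | true  = cong (f x +_) (sumOver-filterᵇ P f xs)
... | false = sumOver-filterᵇ P f xs

sumOver-∑ : (F : Fin n → A → ℕ) (xs : List A) →
            sumOver (λ x → ∑ (λ i → F i x)) xs ≡ ∑ (λ i → sumOver (F i) xs)
sumOver-∑ {n = zero}  F xs = trans (sumOver-const 0 xs) (*-zeroʳ (length xs))
sumOver-∑ {n = suc n} F xs = trans (sumOver-+ (F zero) _ xs) (cong (sumOver (F zero) xs +_) (sumOver-∑ (F ∘ suc) xs))

∑-≤ : (f : Fin n → ℕ) (i : Fin n) → f i ≤ ∑ f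
∑-≤ f zero    = m≤m+n _ _
∑-≤ f (suc i) = ≤-trans (∑-≤ (f ∘ suc) i) (m≤n+m _ _)

*-∑-≤ : (a b : ℕ) (f : Fin n → ℕ) → (∀ i → a * f i ≤ b) → a * ∑ f ≤ n * b
*-∑-≤ {n = zero}  a b f af≤b = ≤-reflexive (*-zeroʳ a)
*-∑-≤ {n = suc n} a b f af≤b = begin
  a * (f zero + ∑ (f ∘ suc))       ≡⟨ *-distribˡ-+ a (f zero) _ ⟩
  a * f zero + a * ∑ (f ∘ suc)     ≤⟨ +-mono-≤ (af≤b zero) (*-∑-≤ a b (f ∘ suc) (af≤b ∘ suc)) ⟩
  b + n * b                        ∎
  where open ≤-Reasoning

-- Each element of `p` is charged one unit of `f`. With this the surviving hidden items are counted
-- by collisions.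
card≤∑ : (p : Subset n) (f : Fin n → ℕ) → (∀ {i} → i ∈ p → 1 ≤ f i) → ∣ p ∣ ≤ ∑ f
card≤∑ []          f h = z≤n
card≤∑ (true  ∷ p) f h = +-mono-≤ (h Vec.here) (card≤∑ p (f ∘ suc) (h ∘ Vec.there))
card≤∑ (false ∷ p) f h = m≤n⇒m≤o+n (f zero) (card≤∑ p (f ∘ suc) (h ∘ Vec.there))

-- Counting the subsets of a given size

-- The possible machine sets of an item sent to `c` machines. The body repeats the list inside
-- `assignments`, so the two agree definitionally.
layer : ∀ m → ℕ → List (Subset m)
layer m c = filterᵇ (λ M → ∣ M ∣ ≡ᵇ c) (allSubsets m)

layerSum : (c : ℕ) → (Subset m → ℕ) → ℕ
layerSum {m} c g = sumOver g (layer m c)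

layerSum-cong : (c : ℕ) {g h : Subset m → ℕ} → g ≗ h → layerSum c g ≡ layerSum c h
layerSum-cong {m} c g≗h = sumOver-cong g≗h (layer m c)

layerSum-0 : (c : ℕ) → layerSum {m} c (const 0) ≡ 0
layerSum-0 {m} c = trans (sumOver-const 0 (layer m c)) (*-zeroʳ (length (layer m c)))

sumOver-allSubsets-suc : (g : Subset (suc m) → ℕ) →
  sumOver g (allSubsets (suc m)) ≡
  sumOver (g ∘ (false ∷_)) (allSubsets m) + sumOver (g ∘ (true ∷_)) (allSubsets m)
sumOver-allSubsets-suc {m} g = begin
  sumOver g (allSubsets (suc m))
    ≡⟨ sumOver-concatMap g _ (allSubsets m) ⟩
  sumOver (λ s → g (false ∷ s) + (g (true ∷ s) + 0)) (allSubsets m)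
    ≡⟨ sumOver-cong (λ s → cong (g (false ∷ s) +_) (+-identityʳ _)) (allSubsets m) ⟩
  sumOver (λ s → g (false ∷ s) + g (true ∷ s)) (allSubsets m)
    ≡⟨ sumOver-+ (g ∘ (false ∷_)) (g ∘ (true ∷_)) (allSubsets m) ⟩
  _ ∎
  where open ≡-Reasoning

-- A weighted Pascal rule: subsets are split by whether they contain the first element.
layerSum-suc : (c : ℕ) (g : Subset (suc m) → ℕ) →
  layerSum (suc c) g ≡ layerSum (suc c) (g ∘ (false ∷_)) + layerSum c (g ∘ (true ∷_))
layerSum-suc {m} c g
  rewrite sumOver-filterᵇ (λ M → ∣ M ∣ ≡ᵇ suc c) g (allSubsets (suc m))
        | sumOver-filterᵇ (λ M → ∣ M ∣ ≡ᵇ suc c) (g ∘ (false ∷_)) (allSubsets m)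
        | sumOver-filterᵇ (λ M → ∣ M ∣ ≡ᵇ c) (g ∘ (true ∷_)) (allSubsets m)
  = sumOver-allSubsets-suc {m} _

layerSum-zero : (g : Subset (suc m) → ℕ) → layerSum 0 g ≡ layerSum 0 (g ∘ (false ∷_))
layerSum-zero {m} g
  rewrite sumOver-filterᵇ (λ M → ∣ M ∣ ≡ᵇ 0) g (allSubsets (suc m))
        | sumOver-filterᵇ (λ M → ∣ M ∣ ≡ᵇ 0) (g ∘ (false ∷_)) (allSubsets m)
  = begin
  _ ≡⟨ sumOver-allSubsets-suc {m} _ ⟩
  a + sumOver (const 0) (allSubsets m) ≡⟨ cong (a +_) (sumOver-const 0 (allSubsets m)) ⟩
  a + length (allSubsets m) * 0        ≡⟨ cong (a +_) (*-zeroʳ (length (allSubsets m))) ⟩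
  a + 0                                ≡⟨ +-identityʳ a ⟩
  a                                    ∎
  where
  open ≡-Reasoning
  a = sumOver (λ M → if ∣ M ∣ ≡ᵇ 0 then g (false ∷ M) else 0) (allSubsets m)

-- The binomial coefficient, defined as a `layerSum` so that `layerSum-suc` serves as its Pascal
-- rule.
binom : ℕ → ℕ → ℕ
binom m c = layerSum {m} c (const 1)

binom-length : ∀ m c → binom m c ≡ length (layer m c)
binom-length m c = sumOver-1 (layer m c)

hits : Fin m → Subset m → ℕ
hits i M = if lookup M i then 1 else 0

misses : Fin m → Subset m → ℕ
misses i M = if lookup M i then 0 else 1

layerSum-∈-zero : (i : Fin m) → layerSum 0 (hits i) ≡ 0
layerSum-∈-zero {suc m} zero    = trans (layerSum-zero {m} _) (layerSum-0 {m} 0)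
layerSum-∈-zero {suc m} (suc i) = trans (layerSum-zero {m} _) (layerSum-∈-zero i)

-- Deleting `i` from a set counted on the left leaves a `c`-subset of the other `m` elements. The
-- proof is by induction on `i`: splitting on the first element gives two smaller counts, which
-- Pascal's rule recombines.
layerSum-∈-suc : (c : ℕ) (i : Fin (suc m)) → layerSum (suc c) (hits i) ≡ binom m c
layerSum-∈-suc {m} c zero =
  trans (layerSum-suc {m} c _) (cong (_+ binom m c) (layerSum-0 {m} (suc c)))
layerSum-∈-suc {suc m} c (suc i) with c
... | zero = begin
  layerSum 1 (hits (suc i))                  ≡⟨ layerSum-suc {suc m} 0 _ ⟩
  layerSum 1 (hits i) + layerSum 0 (hits i) ≡⟨ cong₂ _+_ (layerSum-∈-suc 0 i) (layerSum-∈-zero i) ⟩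
  binom m 0 + 0                           ≡⟨ +-identityʳ _ ⟩
  binom m 0                               ≡⟨ layerSum-zero {m} _ ⟨
  binom (suc m) 0                         ∎
  where open ≡-Reasoning
... | suc c′ = begin
  layerSum (2 + c′) (hits (suc i))                             ≡⟨ layerSum-suc {suc m} (suc c′) _ ⟩
  layerSum (2 + c′) (hits i) + layerSum (suc c′) (hits i)     ≡⟨ cong₂ _+_ (layerSum-∈-suc (suc c′) i) (layerSum-∈-suc c′ i) ⟩
  binom m (suc c′) + binom m c′                             ≡⟨ layerSum-suc {m} c′ _ ⟨
  binom (suc m) (suc c′)                                    ∎
  where open ≡-Reasoning

-- The absorption identity for binomial coefficients, by induction on `m` with Pascal's rule on both
-- sides.
binom-absorb : ∀ m c → suc m * binom m c ≡ suc c * binom (suc m) (suc c)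
binom-absorb zero zero    = refl
binom-absorb zero (suc c) = sym (*-zeroʳ c)
binom-absorb (suc m) zero = begin
  suc (suc m) * binom (suc m) 0               ≡⟨⟩
  binom (suc m) 0 + suc m * binom (suc m) 0   ≡⟨ cong (λ z → binom (suc m) 0 + suc m * z) (layerSum-zero {m} _) ⟩
  binom (suc m) 0 + suc m * binom m 0         ≡⟨ cong (binom (suc m) 0 +_) (binom-absorb m 0) ⟩
  binom (suc m) 0 + 1 * binom (suc m) 1       ≡⟨ arrange (binom (suc m) 0) (binom (suc m) 1) ⟩
  1 * (binom (suc m) 1 + binom (suc m) 0)     ≡⟨ cong (1 *_) (layerSum-suc {suc m} 0 _) ⟨
  1 * binom (suc (suc m)) 1                   ∎
  where
  open ≡-Reasoning
  arrange : ∀ a b → a + 1 * b ≡ 1 * (b + a)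
  arrange = solve-∀
binom-absorb (suc m) (suc c) = begin
  suc (suc m) * x                                             ≡⟨⟩
  x + suc m * x                                               ≡⟨ cong (λ z → x + suc m * z) (layerSum-suc {m} c _) ⟩
  x + suc m * (binom m (suc c) + binom m c)                   ≡⟨ cong (x +_) (*-distribˡ-+ (suc m) (binom m (suc c)) _) ⟩
  x + (suc m * binom m (suc c) + suc m * binom m c)           ≡⟨ cong (x +_) (cong₂ _+_ (binom-absorb m (suc c)) (binom-absorb m c)) ⟩
  x + (suc (suc c) * y + suc c * x)                           ≡⟨ arrange x y c ⟩
  suc (suc c) * (y + x)                                       ≡⟨ cong (suc (suc c) *_) (layerSum-suc {suc m} (suc c) _) ⟨
  suc (suc c) * binom (suc (suc m)) (suc (suc c))             ∎
  where
  open ≡-Reasoning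
  x = binom (suc m) (suc c)
  y = binom (suc m) (suc (suc c))
  arrange : ∀ x y c → x + (suc (suc c) * y + suc c * x) ≡ suc (suc c) * (y + x)
  arrange = solve-∀

-- Absorption gives the probability c/m that a uniformly random `c`-subset contains `i`, here with
-- the denominators cleared.
layerSum-∈ : (c : ℕ) (i : Fin m) → m * layerSum c (hits i) ≡ c * length (layer m c)
layerSum-∈ {m} zero i = trans (cong (m *_) (layerSum-∈-zero i)) (*-zeroʳ m)
layerSum-∈ {suc m} (suc c) i = begin
  suc m * layerSum (suc c) (hits i)       ≡⟨ cong (suc m *_) (layerSum-∈-suc c i) ⟩
  suc m * binom m c                      ≡⟨ binom-absorb m c ⟩
  suc c * binom (suc m) (suc c)          ≡⟨ cong (suc c *_) (binom-length (suc m) (suc c)) ⟩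
  suc c * length (layer (suc m) (suc c)) ∎
  where open ≡-Reasoning

layerSum-∈-≤ : (c C : ℕ) → c ≤ C → (i : Fin m) → m * layerSum c (hits i) ≤ C * length (layer m c)
layerSum-∈-≤ {m} c C c≤C i = ≤-trans (≤-reflexive (layerSum-∈ c i)) (*-monoˡ-≤ (length (layer m c)) c≤C)

-- Among `suc m` machines a given one is missed with probability 1 - c/(m + 1), at most m/(m + 1)
-- because c ≥ 1. Adding `N` to both sides avoids subtraction.
layerSum-∉-≤ : (c : ℕ) → 1 ≤ c → (i : Fin (suc m)) →
               suc m * layerSum c (misses i) ≤ m * length (layer (suc m) c)
layerSum-∉-≤ {m} c 1≤c i = +-cancelˡ-≤ N _ _ (begin
  N + suc m * y                       ≤⟨ +-monoˡ-≤ (suc m * y) (m≤n*m N c ⦃ >-nonZero 1≤c ⦄) ⟩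
  c * N + suc m * y                   ≡⟨ cong (_+ suc m * y) (layerSum-∈ c i) ⟨
  suc m * x + suc m * y               ≡⟨ *-distribˡ-+ (suc m) x y ⟨
  suc m * (x + y)                     ≡⟨ cong (suc m *_) (sumOver-+ (hits i) (misses i) (layer (suc m) c)) ⟨
  suc m * layerSum c (λ M → hits i M + misses i M)
                                      ≡⟨ cong (suc m *_) (layerSum-cong {suc m} c complementary) ⟩
  suc m * binom (suc m) c             ≡⟨ cong (suc m *_) (binom-length (suc m) c) ⟩
  N + m * N                           ∎)
  where
  open ≤-Reasoning
  N = length (layer (suc m) c)
  x = layerSum c (hits i)
  y = layerSum c (misses i)
  complementary : ∀ M → hits i M + misses i M ≡ 1
  complementary M with lookup M i
  ... | true  = refl
  ... | false = refl

-- Product events in the sample space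

-- If g is an indicator, then so is weight p g: of the event that g holds for every item of p.
weight : Subset n → (A → ℕ) → Vec A n → ℕ
weight []          g []      = 1
weight (true  ∷ p) g (M ∷ a) = g M * weight p g a
weight (false ∷ p) g (M ∷ a) = weight p g a

weight-pos : (p : Subset n) (g : A → ℕ) (a : Vec A n) →
             (∀ {x} → x ∈ p → 1 ≤ g (lookup a x)) → 1 ≤ weight p g a
weight-pos []          g []      h = s≤s z≤n
weight-pos (true  ∷ p) g (M ∷ a) h = *-mono-≤ (h Vec.here) (weight-pos p g a (h ∘ Vec.there))
weight-pos (false ∷ p) g (M ∷ a) h = weight-pos p g a (h ∘ Vec.there)

-- A product of naturals vanishes only through a factor. For `misses`, that factor belongs to an
-- item that does reach the machine.
weight-zero : (p : Subset n) (g : A → ℕ) (a : Vec A n) → weight p g a ≡ 0 →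
              ∃ λ x → x ∈ p × g (lookup a x) ≡ 0
weight-zero []          g []      ()
weight-zero (true  ∷ p) g (M ∷ a) eq with m*n≡0⇒m≡0∨n≡0 (g M) eq
... | inj₁ gM≡0 = zero , Vec.here , gM≡0
... | inj₂ w≡0  = let x , x∈p , gx≡0 = weight-zero p g a w≡0 in suc x , Vec.there x∈p , gx≡0
weight-zero (false ∷ p) g (M ∷ a) eq =
  let x , x∈p , gx≡0 = weight-zero p g a eq in suc x , Vec.there x∈p , gx≡0

-- Independence: the sample space is the product of the choices for the first item and for the rest,
-- so the sum of a product factorises.
sumOver-assignments : (c : Fin (suc n) → ℕ) (F : Vec (Subset m) (suc n) → ℕ)
  (f : Subset m → ℕ) (h : Vec (Subset m) n → ℕ) → (∀ M a → F (M ∷ a) ≡ f M * h a) →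
  sumOver F (assignments m c) ≡ layerSum (c zero) f * sumOver h (assignments m (c ∘ suc))
sumOver-assignments {m = m} c F f h F≡ = begin
  sumOver F (assignments m c)                       ≡⟨ sumOver-concatMap F _ (layer m (c zero)) ⟩
  layerSum (c zero) (λ M → sumOver F (map (M ∷_) as)) ≡⟨ layerSum-cong {m} (c zero) inner ⟩
  layerSum (c zero) (λ M → f M * sumOver h as)      ≡⟨ sumOver-*ʳ f (sumOver h as) (layer m (c zero)) ⟩
  layerSum (c zero) f * sumOver h as                ∎
  where
  open ≡-Reasoning
  as = assignments m (c ∘ suc)
  inner : ∀ M → sumOver F (map (M ∷_) as) ≡ f M * sumOver h as
  inner M = trans (sumOver-map F (M ∷_) as) (trans (sumOver-cong (F≡ M) as) (sumOver-*ˡ (f M) h as))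

length-assignments : (c : Fin (suc n) → ℕ) →
  length (assignments m c) ≡ length (layer m (c zero)) * length (assignments m (c ∘ suc))
length-assignments {m = m} c = begin
  length (assignments m c)                  ≡⟨ sumOver-1 (assignments m c) ⟨
  sumOver (const 1) (assignments m c)       ≡⟨ sumOver-assignments {m = m} c (const 1) (const 1) (const 1) (λ _ _ → refl) ⟩
  layerSum {m} (c zero) (const 1) * sumOver (const 1) (assignments m (c ∘ suc))
    ≡⟨ cong₂ _*_ (sumOver-1 (layer m (c zero))) (sumOver-1 (assignments m (c ∘ suc))) ⟩
  _ ∎
  where open ≡-Reasoning

-- Independence multiplies the bound β/α once for each item of `p`; an item outside `p` contributes
-- only the size of its layer.
weight-bound : (α β : ℕ) (g : Subset m → ℕ) (c : Fin n → ℕ) (p : Subset n) →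
  (∀ x → α * layerSum (c x) g ≤ β * length (layer m (c x))) →
  α ^ ∣ p ∣ * sumOver (weight p g) (assignments m c) ≤ β ^ ∣ p ∣ * length (assignments m c)
weight-bound α β g c [] h = ≤-refl
weight-bound {m = m} α β g c (true ∷ p) h = begin
  α * α ^ ∣ p ∣ * sumOver (weight (true ∷ p) g) (assignments m c)
    ≡⟨ cong (α * α ^ ∣ p ∣ *_) (sumOver-assignments c _ g (weight p g) (λ _ _ → refl)) ⟩
  α * α ^ ∣ p ∣ * (layerSum (c zero) g * s)
    ≡⟨ [m*n]*[o*p]≡[m*o]*[n*p] α (α ^ ∣ p ∣) (layerSum (c zero) g) s ⟩
  (α * layerSum (c zero) g) * (α ^ ∣ p ∣ * s)
    ≤⟨ *-mono-≤ (h zero) (weight-bound α β g (c ∘ suc) p (h ∘ suc)) ⟩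
  (β * l) * (β ^ ∣ p ∣ * l′)
    ≡⟨ [m*n]*[o*p]≡[m*o]*[n*p] β l (β ^ ∣ p ∣) l′ ⟩
  β * β ^ ∣ p ∣ * (l * l′)
    ≡⟨ cong (β * β ^ ∣ p ∣ *_) (length-assignments {m = m} c) ⟨
  β * β ^ ∣ p ∣ * length (assignments m c) ∎
  where
  open ≤-Reasoning
  s  = sumOver (weight p g) (assignments m (c ∘ suc))
  l  = length (layer m (c zero))
  l′ = length (assignments m (c ∘ suc))
weight-bound {m = m} α β g c (false ∷ p) h = begin
  α ^ ∣ p ∣ * sumOver (weight (false ∷ p) g) (assignments m c)
    ≡⟨ cong (α ^ ∣ p ∣ *_) (sumOver-assignments c _ (const 1) (weight p g) (λ _ _ → sym (+-identityʳ _))) ⟩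
  α ^ ∣ p ∣ * (layerSum {m} (c zero) (const 1) * s)
    ≡⟨ cong (λ z → α ^ ∣ p ∣ * (z * s)) (sumOver-1 (layer m (c zero))) ⟩
  α ^ ∣ p ∣ * (l * s)
    ≡⟨ swap (α ^ ∣ p ∣) l s ⟩
  l * (α ^ ∣ p ∣ * s)
    ≤⟨ *-monoʳ-≤ l (weight-bound α β g (c ∘ suc) p (h ∘ suc)) ⟩
  l * (β ^ ∣ p ∣ * l′)
    ≡⟨ swap l (β ^ ∣ p ∣) l′ ⟩
  β ^ ∣ p ∣ * (l * l′)
    ≡⟨ cong (β ^ ∣ p ∣ *_) (length-assignments {m = m} c) ⟨
  β ^ ∣ p ∣ * length (assignments m c) ∎
  where
  open ≤-Reasoning
  s  = sumOver (weight p g) (assignments m (c ∘ suc))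
  l  = length (layer m (c zero))
  l′ = length (assignments m (c ∘ suc))
  swap : ∀ a b c → a * (b * c) ≡ b * (a * c)
  swap = solve-∀

-- Bernoulli's inequality for (1 + 1/d)^l, with the denominators cleared.
bernoulli : ∀ d l → d ^ l * (suc d + l) ≤ suc d ^ l * suc d
bernoulli d zero    = ≤-reflexive (cong (1 *_) (+-identityʳ (suc d)))
bernoulli d (suc l) = begin
  -- The added slack completes d(d + l + 2) to the product (d + 1)(d + 1 + l).
  d * d ^ l * (suc d + suc l)                 ≤⟨ m≤m+n _ (d ^ l * suc l) ⟩
  d * d ^ l * (suc d + suc l) + d ^ l * suc l ≡⟨ arrange d l (d ^ l) ⟩
  suc d * (d ^ l * (suc d + l))               ≤⟨ *-monoʳ-≤ (suc d) (bernoulli d l) ⟩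
  suc d * (suc d ^ l * suc d)                 ≡⟨ *-assoc (suc d) (suc d ^ l) (suc d) ⟨
  suc d * suc d ^ l * suc d                   ∎
  where
  open ≤-Reasoning
  arrange : ∀ d l e → d * e * (suc d + suc l) + e * suc l ≡ suc d * (e * (suc d + l))
  arrange = solve-∀

weight-hits : ∀ C (c : Fin n → ℕ) → (∀ x → c x ≤ C) → (p : Subset n) (i : Fin m) →
  m ^ ∣ p ∣ * sumOver (weight p (hits i)) (assignments m c) ≤ C ^ ∣ p ∣ * length (assignments m c)
weight-hits {m = m} C c c≤C p i =
  weight-bound m C (hits i) c p (λ x → layerSum-∈-≤ (c x) C (c≤C x) i)

-- With m = d + 1 and l the size of `p`, independence gives (1 - 1/m)^l. Bernoulli turns this into
-- m/(m + l), which enough copies make arbitrarily small.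
weight-misses : ∀ d (c : Fin n → ℕ) → (∀ x → 1 ≤ c x) → (p : Subset n) (i : Fin (suc d)) →
  (suc d + ∣ p ∣) * sumOver (weight p (misses i)) (assignments (suc d) c)
    ≤ suc d * length (assignments (suc d) c)
weight-misses d c 1≤c p i = *-cancelˡ-≤ (suc d ^ l) ⦃ m^n≢0 (suc d) l ⦄ (begin
  suc d ^ l * ((suc d + l) * w) ≡⟨ swap (suc d ^ l) (suc d + l) w ⟩
  (suc d + l) * (suc d ^ l * w) ≤⟨ *-monoʳ-≤ (suc d + l) (weight-bound (suc d) d (misses i) c p (λ x → layerSum-∉-≤ (c x) (1≤c x) i)) ⟩
  (suc d + l) * (d ^ l * N)     ≡⟨ swap′ (suc d + l) (d ^ l) N ⟩
  d ^ l * (suc d + l) * N       ≤⟨ *-monoˡ-≤ N (bernoulli d l) ⟩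
  suc d ^ l * suc d * N         ≡⟨ *-assoc (suc d ^ l) (suc d) N ⟩
  suc d ^ l * (suc d * N)       ∎)
  where
  open ≤-Reasoning
  l = ∣ p ∣
  N = length (assignments (suc d) c)
  w = sumOver (weight p (misses i)) (assignments (suc d) c)
  swap : ∀ a b c → a * (b * c) ≡ b * (a * c)
  swap = solve-∀
  swap′ : ∀ a b c → a * (b * c) ≡ b * a * c
  swap′ = solve-∀

-- Coverage functions

card-∪ : (p q : Subset n) → ∣ p ∪ q ∣ ≤ ∣ p ∣ + ∣ q ∣
card-∪ []          []          = z≤n
card-∪ (true  ∷ p) (true  ∷ q) = s≤s (≤-trans (card-∪ p q) (+-monoʳ-≤ ∣ p ∣ (n≤1+n ∣ q ∣)))
card-∪ (true  ∷ p) (false ∷ q) = s≤s (card-∪ p q)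
card-∪ (false ∷ p) (true  ∷ q) = ≤-trans (s≤s (card-∪ p q)) (≤-reflexive (sym (+-suc ∣ p ∣ ∣ q ∣)))
card-∪ (false ∷ p) (false ∷ q) = card-∪ p q

card-++ : (p : Subset m) (q : Subset n) → ∣ p Vec.++ q ∣ ≡ ∣ p ∣ + ∣ q ∣
card-++ []          q = refl
card-++ (true  ∷ p) q = cong suc (card-++ p q)
card-++ (false ∷ p) q = card-++ p q

card<n⇒∃∉ : (p : Subset n) → ∣ p ∣ < n → ∃ λ i → i ∉ p
card<n⇒∃∉ (true ∷ p)  (s≤s ∣p∣<n) =
  let i , i∉p = card<n⇒∃∉ p ∣p∣<n in suc i , λ { (Vec.there i∈p) → i∉p i∈p }
card<n⇒∃∉ (false ∷ p) _           = zero , λ ()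

injective⇒≤card : (f : Fin m → Fin n) → (∀ {i j} → f i ≡ f j → i ≡ j) →
                  (p : Subset n) → (∀ i → f i ∈ p) → m ≤ ∣ p ∣
injective⇒≤card {zero}  f f-inj p f∈p = z≤n
injective⇒≤card {suc m} f f-inj p f∈p = ≤-<-trans
  (injective⇒≤card (f ∘ suc) (Fin.suc-injective ∘ f-inj) (p Subset.- f zero)
    (λ i → x∈p∧x≢y⇒x∈p-y (f∈p (suc i)) (λ eq → Fin.0≢1+n (sym (f-inj eq)))))
  (x∈p⇒∣p-x∣<∣p∣ (f∈p zero))

∈-⋃⁻ : (f : Fin m → Subset n) {x : Fin n} → x ∈ ⋃ (toList (tabulate f)) → ∃ λ i → x ∈ f i
∈-⋃⁻ {zero}  f x∈ = contradiction x∈ ∉⊥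
∈-⋃⁻ {suc m} f x∈ with x∈p∪q⁻ (f zero) _ x∈
... | inj₁ x∈f0 = zero , x∈f0
... | inj₂ x∈⋃  = let i , x∈fi = ∈-⋃⁻ (f ∘ suc) x∈⋃ in suc i , x∈fi

∈-covered⁺ : (cv : Cover n u) {S : Subset n} {x : Fin n} {e : Fin u} →
             x ∈ S → e ∈ cv x → e ∈ covered cv S
∈-covered⁺ cv {_ ∷ S}  Vec.here       e∈ = p⊆p∪q _ e∈
∈-covered⁺ cv {_ ∷ S} (Vec.there x∈S) e∈ = q⊆p∪q _ _ (∈-covered⁺ (cv ∘ suc) x∈S e∈)

∈-covered⁻ : (cv : Cover n u) (S : Subset n) {e : Fin u} →
             e ∈ covered cv S → ∃ λ x → x ∈ S × e ∈ cv x
∈-covered⁻ cv []      e∈ = contradiction e∈ ∉⊥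
∈-covered⁻ cv (s ∷ S) e∈ with x∈p∪q⁻ _ (covered (cv ∘ suc) S) e∈
∈-covered⁻ cv (true  ∷ S) e∈ | inj₁ e∈cv0 = zero , Vec.here , e∈cv0
∈-covered⁻ cv (false ∷ S) e∈ | inj₁ e∈⊥   = contradiction e∈⊥ ∉⊥
∈-covered⁻ cv (s ∷ S)     e∈ | inj₂ e∈′   =
  let x , x∈S , e∈cvx = ∈-covered⁻ (cv ∘ suc) S e∈′ in suc x , Vec.there x∈S , e∈cvx

covered-mono : (cv : Cover n u) {S T : Subset n} → S ⊆ T → covered cv S ⊆ covered cv T
covered-mono cv {S} S⊆T e∈ = let x , x∈S , e∈cvx = ∈-covered⁻ cv S e∈ in ∈-covered⁺ cv (S⊆T x∈S) e∈cvx

cov-mono : (cv : Cover n u) {S T : Subset n} → S ⊆ T → cov cv S ≤ cov cv T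
cov-mono cv S⊆T = p⊆q⇒∣p∣≤∣q∣ (covered-mono cv S⊆T)

cov≤card : (cv : Cover n u) (S : Subset n) → (∀ {x} → x ∈ S → ∣ cv x ∣ ≤ 1) → cov cv S ≤ ∣ S ∣
cov≤card {u = u} cv [] h = ≤-reflexive (∣⊥∣≡0 u)
cov≤card {u = u} cv (true ∷ S) h = ≤-trans (card-∪ (cv zero) _)
  (+-mono-≤ (h Vec.here) (cov≤card (cv ∘ suc) S (h ∘ Vec.there)))
cov≤card {u = u} cv (false ∷ S) h = ≤-trans (card-∪ (⊥ {u}) _)
  (≤-trans (+-monoˡ-≤ _ (≤-reflexive (∣⊥∣≡0 u))) (cov≤card (cv ∘ suc) S (h ∘ Vec.there)))

covered-hom : ∀ {v} (φ : Subset u → Subset v) → φ ⊥ ≡ ⊥ → (∀ p q → φ (p ∪ q) ≡ φ p ∪ φ q) →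
              (cv : Cover n u) (S : Subset n) → covered (φ ∘ cv) S ≡ φ (covered cv S)
covered-hom φ φ⊥ φ∪ cv []          = sym φ⊥
covered-hom φ φ⊥ φ∪ cv (true  ∷ S) = trans (cong (φ (cv zero) ∪_) (covered-hom φ φ⊥ φ∪ (cv ∘ suc) S)) (sym (φ∪ _ _))
covered-hom φ φ⊥ φ∪ cv (false ∷ S) = trans (cong₂ _∪_ (sym φ⊥) (covered-hom φ φ⊥ φ∪ (cv ∘ suc) S)) (sym (φ∪ _ _))

⊥-++ : ∀ m → ⊥ {m} Vec.++ ⊥ {n} ≡ ⊥
⊥-++ zero    = refl
⊥-++ (suc m) = cong (false ∷_) (⊥-++ m)

covered-++ : ∀ {v} (cv : Cover n u) (cw : Cover n v) (S : Subset n) →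
             covered (λ x → cv x Vec.++ cw x) S ≡ covered cv S Vec.++ covered cw S
covered-++ {u = u} cv cw []          = sym (⊥-++ u)
covered-++ cv cw (true  ∷ S) = trans (cong (_ ∪_) (covered-++ (cv ∘ suc) (cw ∘ suc) S)) (zipWith-++ _∨_ (cv zero) (cw zero) _ _)
covered-++ {u = u} cv cw (false ∷ S) = trans (cong₂ _∪_ (sym (⊥-++ u)) (covered-++ (cv ∘ suc) (cw ∘ suc) S)) (zipWith-++ _∨_ (⊥ {u}) ⊥ _ _)

-- Blow-up: every point becomes r points.
blocks : ∀ r → Subset n → Subset (n * r)
blocks r p = Vec.concat (Vec.map (Vec.replicate r) p)

blocks-⊥ : ∀ r n → blocks r (⊥ {n}) ≡ ⊥
blocks-⊥ r zero    = refl
blocks-⊥ r (suc n) = trans (cong (⊥ Vec.++_) (blocks-⊥ r n)) (⊥-++ r)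

blocks-∪ : ∀ r (p q : Subset n) → blocks r (p ∪ q) ≡ blocks r p ∪ blocks r q
blocks-∪ r []      []      = refl
blocks-∪ r (x ∷ p) (y ∷ q) = begin
  Vec.replicate r _ Vec.++ blocks r (p ∪ q)
    ≡⟨ cong₂ Vec._++_ (sym (zipWith-replicate {n = r} _ x y)) (blocks-∪ r p q) ⟩
  (Vec.replicate r x ∪ Vec.replicate r y) Vec.++ (blocks r p ∪ blocks r q)
    ≡⟨ zipWith-++ _∨_ (Vec.replicate r x) (blocks r p) (Vec.replicate r y) (blocks r q) ⟨
  blocks r (x ∷ p) ∪ blocks r (y ∷ q) ∎
  where open ≡-Reasoning

card-blocks : ∀ r (p : Subset n) → ∣ blocks r p ∣ ≡ ∣ p ∣ * r
card-blocks r []          = refl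
card-blocks r (true  ∷ p) = trans (card-++ (⊤ {r}) (blocks r p)) (cong₂ _+_ (∣⊤∣≡n r) (card-blocks r p))
card-blocks r (false ∷ p) = trans (card-++ (⊥ {r}) (blocks r p)) (cong₂ _+_ (∣⊥∣≡0 r) (card-blocks r p))

-- Blowing up points realises weights `r` and `s` by plain coverage, so the value splits into two
-- unweighted coverage functions.
cov-blocks : ∀ {v} r s (cv : Cover n u) (cw : Cover n v) (S : Subset n) →
  cov (λ x → blocks r (cv x) Vec.++ blocks s (cw x)) S ≡ cov cv S * r + cov cw S * s
cov-blocks {u = u} {v} r s cv cw S = begin
  ∣ covered (λ x → blocks r (cv x) Vec.++ blocks s (cw x)) S ∣
    ≡⟨ cong ∣_∣ (covered-++ (blocks r ∘ cv) (blocks s ∘ cw) S) ⟩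
  ∣ covered (blocks r ∘ cv) S Vec.++ covered (blocks s ∘ cw) S ∣
    ≡⟨ cong ∣_∣ (cong₂ Vec._++_ (covered-hom (blocks r) (blocks-⊥ r u) (blocks-∪ r) cv S)
                                (covered-hom (blocks s) (blocks-⊥ s v) (blocks-∪ s) cw S)) ⟩
  ∣ blocks r (covered cv S) Vec.++ blocks s (covered cw S) ∣
    ≡⟨ card-++ (blocks r (covered cv S)) _ ⟩
  ∣ blocks r (covered cv S) ∣ + ∣ blocks s (covered cw S) ∣
    ≡⟨ cong₂ _+_ (card-blocks r (covered cv S)) (card-blocks s (covered cw S)) ⟩
  cov cv S * r + cov cw S * s ∎
  where open ≡-Reasoning

-- Comparing `fk` and `opt` with the coverage of a single set.

⊆ᵇ-sound : (p q : Subset n) → T (p ⊆ᵇ q) → p ⊆ q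
⊆ᵇ-sound (false ∷ p) (_    ∷ q) h (Vec.there x∈p) = Vec.there (⊆ᵇ-sound p q h x∈p)
⊆ᵇ-sound (true  ∷ p) (true ∷ q) h Vec.here        = Vec.here
⊆ᵇ-sound (true  ∷ p) (true ∷ q) h (Vec.there x∈p) = Vec.there (⊆ᵇ-sound p q h x∈p)

⊆ᵇ-⊤ : (p : Subset n) → T (p ⊆ᵇ ⊤)
⊆ᵇ-⊤ []          = _
⊆ᵇ-⊤ (true  ∷ p) = ⊆ᵇ-⊤ p
⊆ᵇ-⊤ (false ∷ p) = ⊆ᵇ-⊤ p

allSubsets-complete : (p : Subset n) → p ∈ˡ allSubsets n
allSubsets-complete []      = here refl
allSubsets-complete (s ∷ p) =
  ∈-concatMap⁺ (λ p → (false ∷ p) ∷ (true ∷ p) ∷ []) (Any.map (λ { refl → extend s }) (allSubsets-complete p))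
  where
  extend : ∀ s {p : Subset n} → (s ∷ p) ∈ˡ ((false ∷ p) ∷ (true ∷ p) ∷ [])
  extend false = here refl
  extend true  = there (here refl)

∈⇒≤maxList : {x : ℕ} {xs : List ℕ} → x ∈ˡ xs → x ≤ maxList xs
∈⇒≤maxList {xs = y ∷ ys} (here refl)  = m≤m⊔n y (maxList ys)
∈⇒≤maxList {xs = y ∷ ys} (there x∈ys) = ≤-trans (∈⇒≤maxList x∈ys) (m≤n⊔m y (maxList ys))

cov≤opt : (cv : Cover n u) (k : ℕ) (S : Subset n) → ∣ S ∣ ≤ k → cov cv S ≤ opt cv k
cov≤opt cv k S ∣S∣≤k = ∈⇒≤maxList (∈-map⁺ (cov cv) (∈-filter⁺ _ (allSubsets-complete S)
  (Equivalence.from T-∧ (⊆ᵇ-⊤ S , ≤⇒≤ᵇ ∣S∣≤k))))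

fk≤cov : (cv : Cover n u) (k : ℕ) (S : Subset n) → fk cv k S ≤ cov cv S
fk≤cov {n = n} cv k S = go (allSubsets n)
  where
  go : ∀ Ss → maxList (map (cov cv) (filterᵇ (λ S′ → (S′ ⊆ᵇ S) ∧ (∣ S′ ∣ ≤ᵇ k)) Ss)) ≤ cov cv S
  go []        = z≤n
  go (S′ ∷ Ss) with S′ ⊆ᵇ S in eq | ∣ S′ ∣ ≤ᵇ k
  ... | true  | true  = ⊔-lub (cov-mono cv (⊆ᵇ-sound S′ S (subst T (sym eq) _))) (go Ss)
  ... | true  | false = go Ss
  ... | false | _     = go Ss

-- Linearity of expectation with a uniform bound on the terms; it plays the part of a union bound,
-- `a` being a cleared denominator.
*-sumOver-∑-≤ : (a b : ℕ) (F : Fin n → A → ℕ) (xs : List A) →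
  (∀ i → a * sumOver (F i) xs ≤ b) → a * sumOver (λ x → ∑ (λ i → F i x)) xs ≤ n * b
*-sumOver-∑-≤ a b F xs aF≤b =
  ≤-trans (≤-reflexive (cong (a *_) (sumOver-∑ F xs))) (*-∑-≤ a b (λ i → sumOver (F i) xs) aF≤b)

∑≡0⇒≡0 : (f : Fin n → ℕ) → ∑ f ≡ 0 → ∀ i → f i ≡ 0
∑≡0⇒≡0 f ∑f≡0 i = n≤0⇒n≡0 (≤-trans (∑-≤ f i) (≤-reflexive ∑f≡0))

∈-tabulate⁺ : (f : Fin n → Bool) {x : Fin n} → f x ≡ true → x ∈ tabulate f
∈-tabulate⁺ f {x} fx = lookup⇒[]= x _ (trans (lookup∘tabulate f x) fx)

∈-tabulate⁻ : (f : Fin n → Bool) {x : Fin n} → x ∈ tabulate f → f x ≡ true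
∈-tabulate⁻ f {x} x∈ = trans (sym (lookup∘tabulate f x)) ([]=⇒lookup x∈)

∪-lub : {p q r : Subset n} → p ⊆ r → q ⊆ r → p ∪ q ⊆ r
∪-lub {p = p} {q} p⊆r q⊆r x∈ with x∈p∪q⁻ p q x∈
... | inj₁ x∈p = p⊆r x∈p
... | inj₂ x∈q = q⊆r x∈q

⁅⁆-⊆ : {x : Fin n} {p : Subset n} → x ∈ p → ⁅ x ⁆ ⊆ p
⁅⁆-⊆ {x = x} x∈p y∈ = subst (_∈ _) (sym (x∈⁅y⁆⇒x≡y x y∈)) x∈p

greedy⊆ : {cv : Cover n u} {k : ℕ} {T S R : Subset n} → GreedyFrom cv k T S R → S ⊆ T → R ⊆ T
greedy⊆ (stop _)                S⊆T = S⊆T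
greedy⊆ (step x _ x∈T _ _ next) S⊆T = greedy⊆ next (∪-lub S⊆T (⁅⁆-⊆ x∈T))

-- The hard instance

module HardInstance (h L : ℕ) where

  -- The parameter `h` is k - 1, which avoids truncated subtraction, and `L` is the number of decoys
  -- per left block. In total `points` equals 2K².
  K items points : ℕ
  K      = suc h
  items  = suc (h + L * K)
  points = K * suc K + h * K

  -- Item 0 is the big item; the next h items are the hidden ones, followed by L decoys per left block.
  leftCover : Cover items K
  leftCover zero    = ⊤
  leftCover (suc y) = [ const ⊥ , ⁅_⁆ ∘ proj₂ ∘ remQuot {L} K ]′ (splitAt h y)

  rightCover : Cover items h
  rightCover zero    = ⊥
  rightCover (suc y) = [ ⁅_⁆ , const ⊥ ]′ (splitAt h y)

  cover : Cover items points
  cover x = blocks (suc K) (leftCover x) Vec.++ blocks K (rightCover x)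

  cov-cover : ∀ S → cov cover S ≡ cov leftCover S * suc K + cov rightCover S * K
  cov-cover = cov-blocks (suc K) K leftCover rightCover

  hidden : Fin h → Fin items
  hidden i = suc (i ↑ˡ (L * K))

  decoy : Fin L → Fin K → Fin items
  decoy l j = suc (h ↑ʳ combine l j)

  leftCover-hidden : ∀ i → leftCover (hidden i) ≡ ⊥
  leftCover-hidden i rewrite Fin.splitAt-↑ˡ h i (L * K) = refl

  rightCover-hidden : ∀ i → rightCover (hidden i) ≡ ⁅ i ⁆
  rightCover-hidden i rewrite Fin.splitAt-↑ˡ h i (L * K) = refl

  leftCover-decoy : ∀ l j → leftCover (decoy l j) ≡ ⁅ j ⁆
  leftCover-decoy l j
    rewrite Fin.splitAt-↑ʳ h (L * K) (combine l j) = cong (⁅_⁆ ∘ proj₂) (Fin.remQuot-combine l j)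

  ∈-rightCover⁻ : ∀ x {i} → i ∈ rightCover x → x ≡ hidden i
  ∈-rightCover⁻ zero    i∈ = contradiction i∈ ∉⊥
  ∈-rightCover⁻ (suc y) i∈ with splitAt h y in eq
  ... | inj₁ i′ rewrite x∈⁅y⁆⇒x≡y i′ i∈ = cong suc (sym (Fin.splitAt⁻¹-↑ˡ eq))
  ... | inj₂ _  = contradiction i∈ ∉⊥

  card-leftCover : ∀ x → x ≢ zero → ∣ leftCover x ∣ ≤ 1
  card-leftCover zero    x≢0 = contradiction refl x≢0
  card-leftCover (suc y) _ with splitAt h y
  ... | inj₁ _ = ≤-trans (≤-reflexive (∣⊥∣≡0 K)) z≤n
  ... | inj₂ z = ≤-reflexive (∣⁅x⁆∣≡1 (proj₂ (remQuot {L} K z)))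

  -- Greedy and local search on a machine without the big item.

  Full : Subset items → Set
  Full T = ∀ j → ∃ λ y → y ∈ T × j ∈ leftCover y

  NoHidden : Subset items → Set
  NoHidden R = ∀ i → hidden i ∉ R

  -- Without the big item, each member of `S` covers at most one left block. Fewer than `K` members
  -- leave some block `j` uncovered, and an item of `T` covering it gains at least K + 1, whereas a
  -- hidden item gains at most K.
  decoy-beats-hidden : ∀ {S T} → zero ∉ S → ∣ S ∣ < K → Full T →
    ∃ λ y → y ∈ T × y ∉ S × (∀ i → cov cover (S ∪ ⁅ hidden i ⁆) < cov cover (S ∪ ⁅ y ⁆))
  decoy-beats-hidden {S} {T} 0∉S ∣S∣<K full
    with card<n⇒∃∉ (covered leftCover S)
           (≤-<-trans (cov≤card leftCover S λ {x} x∈S → card-leftCover x λ { refl → 0∉S x∈S }) ∣S∣<K)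
  ... | j , j∉ with full j
  ... | y , y∈T , j∈y = y , y∈T , (λ y∈S → j∉ (∈-covered⁺ leftCover y∈S j∈y)) , worse
    where
    l = cov leftCover S
    r = cov rightCover S
    left-hidden : ∀ i → covered leftCover (S ∪ ⁅ hidden i ⁆) ⊆ covered leftCover S
    left-hidden i e∈ with ∈-covered⁻ leftCover _ e∈
    ... | x , x∈ , e∈x with x∈p∪q⁻ S _ x∈
    ... | inj₁ x∈S = ∈-covered⁺ leftCover x∈S e∈x
    ... | inj₂ x∈⁅⁆ rewrite x∈⁅y⁆⇒x≡y (hidden i) x∈⁅⁆ | leftCover-hidden i = contradiction e∈x ∉⊥
    right-hidden : ∀ i → covered rightCover (S ∪ ⁅ hidden i ⁆) ⊆ covered rightCover S ∪ ⁅ i ⁆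
    right-hidden i e∈ with ∈-covered⁻ rightCover _ e∈
    ... | x , x∈ , e∈x with x∈p∪q⁻ S _ x∈
    ... | inj₁ x∈S = p⊆p∪q _ (∈-covered⁺ rightCover x∈S e∈x)
    ... | inj₂ x∈⁅⁆ rewrite x∈⁅y⁆⇒x≡y (hidden i) x∈⁅⁆ | rightCover-hidden i = q⊆p∪q _ _ e∈x
    left-decoy : l < cov leftCover (S ∪ ⁅ y ⁆)
    left-decoy = p⊂q⇒∣p∣<∣q∣
      (covered-mono leftCover {S} {S ∪ ⁅ y ⁆} (p⊆p∪q ⁅ y ⁆) , j , ∈-covered⁺ leftCover (q⊆p∪q S _ (x∈⁅x⁆ y)) j∈y , j∉)
    -- The strict inequality comes from the difference of one between block sizes k + 1 and k.
    arrange : ∀ l r k → suc (l * suc k + (r + 1) * k) ≡ suc l * suc k + r * k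
    arrange = solve-∀
    worse : ∀ i → cov cover (S ∪ ⁅ hidden i ⁆) < cov cover (S ∪ ⁅ y ⁆)
    worse i = begin
      suc (cov cover (S ∪ ⁅ hidden i ⁆))
        ≡⟨ cong suc (cov-cover (S ∪ ⁅ hidden i ⁆)) ⟩
      suc (cov leftCover (S ∪ ⁅ hidden i ⁆) * suc K + cov rightCover (S ∪ ⁅ hidden i ⁆) * K)
        ≤⟨ s≤s (+-mono-≤ (*-monoˡ-≤ (suc K) (p⊆q⇒∣p∣≤∣q∣ (left-hidden i)))
                         (*-monoˡ-≤ K (≤-trans (p⊆q⇒∣p∣≤∣q∣ (right-hidden i)) (card-∪ (covered rightCover S) ⁅ i ⁆)))) ⟩
      suc (l * suc K + (r + ∣ ⁅ i ⁆ ∣) * K)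
        ≡⟨ cong (λ z → suc (l * suc K + (r + z) * K)) (∣⁅x⁆∣≡1 i) ⟩
      suc (l * suc K + (r + 1) * K)
        ≡⟨ arrange l r K ⟩
      suc l * suc K + r * K
        ≤⟨ +-mono-≤ (*-monoˡ-≤ (suc K) left-decoy) (*-monoˡ-≤ K (cov-mono rightCover {S} {S ∪ ⁅ y ⁆} (p⊆p∪q ⁅ y ⁆))) ⟩
      cov leftCover (S ∪ ⁅ y ⁆) * suc K + cov rightCover (S ∪ ⁅ y ⁆) * K
        ≡⟨ cov-cover (S ∪ ⁅ y ⁆) ⟨
      cov cover (S ∪ ⁅ y ⁆) ∎
      where open ≤-Reasoning

  -- `NoHidden` is an invariant of the run: choosing a hidden item would contradict maximality of
  -- its marginal value.
  greedy-noHidden : ∀ {T S R} → GreedyFrom cover K T S R →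
                    zero ∉ T → Full T → S ⊆ T → NoHidden S → NoHidden R
  greedy-noHidden (stop _) 0∉T full S⊆T noS = noS
  greedy-noHidden {T} {S} (step x ∣S∣<K x∈T x∉S best next) 0∉T full S⊆T noS =
    greedy-noHidden next 0∉T full (∪-lub S⊆T (⁅⁆-⊆ x∈T)) noS′
    where
    noS′ : NoHidden (S ∪ ⁅ x ⁆)
    noS′ i hi∈ with x∈p∪q⁻ S _ hi∈
    ... | inj₁ hi∈S = noS i hi∈S
    ... | inj₂ hi∈x with refl ← x∈⁅y⁆⇒x≡y x hi∈x =
      let y , y∈T , y∉S , worse = decoy-beats-hidden (0∉T ∘ S⊆T) ∣S∣<K full in
      -- Truncated subtraction keeps the inequality strict because, by monotonicity, the smaller
      -- value is at least `cov cover S`.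
      <⇒≱ (∸-monoˡ-< (worse i) (cov-mono cover {S} {S ∪ ⁅ hidden i ⁆} (p⊆p∪q ⁅ hidden i ⁆))) (best y y∈T y∉S)

  -- Dropping a hidden item from `R` leaves fewer than `K` items, so exchanging it for the item from
  -- `decoy-beats-hidden` would be a strict improvement.
  localOpt-noHidden : ∀ {T R} → IsLocalOpt cover K T R → zero ∉ T → Full T → NoHidden R
  localOpt-noHidden {T} {R} (R⊆T , ∣R∣≤K , best) 0∉T full i hi∈R =
    let y , y∈T , y∉S , worse = decoy-beats-hidden {S = S} (0∉T ∘ R⊆T ∘ S⊆R)
                                  (<-≤-trans (x∈p⇒∣p-x∣<∣p∣ hi∈R) ∣R∣≤K) full
        -- Only the dropped hidden item lies in `R` but not in `S`, and `y` differs from it since it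
        -- strictly beats it.
        y∉R = λ y∈R → y∉S (x∈p∧x≢y⇒x∈p-y {y = hidden i} y∈R λ y≡hi → <-irrefl (cong (λ z → cov cover (S ∪ ⁅ z ⁆)) (sym y≡hi)) (worse i))
    in <⇒≱ (≤-<-trans (cov-mono cover {R} {S ∪ ⁅ hidden i ⁆} R⊆) (worse i)) (best (hidden i) y hi∈R y∈T y∉R)
    where
    S = R Subset.- hidden i
    S⊆R : S ⊆ R
    S⊆R = p─q⊆p R ⁅ hidden i ⁆
    R⊆ : R ⊆ S ∪ ⁅ hidden i ⁆
    R⊆ {x} x∈R with x Fin.≟ hidden i
    ... | yes refl = q⊆p∪q S _ (x∈⁅x⁆ x)
    ... | no  x≢hi = p⊆p∪q ⁅ hidden i ⁆ (x∈p∧x≢y⇒x∈p-y {y = hidden i} x∈R x≢hi)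

  -- Lower bound on the optimum.

  optimal : Fin K → Fin items
  optimal zero    = zero
  optimal (suc i) = hidden i

  points≤opt : points ≤ opt cover K
  points≤opt = begin
    K * suc K + h * K
      ≡⟨ cong₂ (λ a b → a * suc K + b * K) (∣⊤∣≡n K) (∣⊤∣≡n h) ⟨
    ∣ ⊤ {K} ∣ * suc K + ∣ ⊤ {h} ∣ * K
      ≤⟨ +-mono-≤ (*-monoˡ-≤ (suc K) (p⊆q⇒∣p∣≤∣q∣ {p = ⊤} λ _ → ∈-covered⁺ leftCover (optimal∈ zero) ∈⊤))
                  (*-monoˡ-≤ K (p⊆q⇒∣p∣≤∣q∣ {p = ⊤} λ {i} _ → ∈-covered⁺ rightCover (optimal∈ (suc i)) (i∈ i))) ⟩
    cov leftCover O * suc K + cov rightCover O * K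
      ≡⟨ cov-cover O ⟨
    cov cover O
      ≤⟨ cov≤opt cover K O ∣O∣≤K ⟩
    opt cover K ∎
    where
    open ≤-Reasoning
    -- The image of `optimal`, written as a coverage by singletons so that `cov≤card` bounds its
    -- size.
    O = covered (⁅_⁆ ∘ optimal) ⊤
    optimal∈ : ∀ j → optimal j ∈ O
    optimal∈ j = ∈-covered⁺ (⁅_⁆ ∘ optimal) (∈⊤ {x = j}) (x∈⁅x⁆ (optimal j))
    i∈ : ∀ i → i ∈ rightCover (hidden i)
    i∈ i rewrite rightCover-hidden i = x∈⁅x⁆ i
    ∣O∣≤K : ∣ O ∣ ≤ K
    ∣O∣≤K = ≤-trans (cov≤card (⁅_⁆ ∘ optimal) ⊤ λ {j} _ → ≤-reflexive (∣⁅x⁆∣≡1 (optimal j)))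
                    (≤-reflexive (∣⊤∣≡n K))

  -- Bad events, and the core-set value of a single outcome.

  withBig : Fin h → Subset items
  withBig i = true ∷ ⁅ i ↑ˡ (L * K) ⁆

  -- The leading `false` excludes the big item, which also covers block `j`.
  decoys : Fin K → Subset items
  decoys j = false ∷ tabulate (λ y → lookup (leftCover (suc y)) j)

  L≤card-decoys : ∀ j → L ≤ ∣ decoys j ∣
  L≤card-decoys j = injective⇒≤card (λ l → decoy l j)
    (λ {l} {l′} eq → Fin.combine-injectiveˡ l j l′ j (Fin.↑ʳ-injective h _ _ (Fin.suc-injective eq)))
    (decoys j)
    (λ l → Vec.there (∈-tabulate⁺ _ ([]=⇒lookup (subst (j ∈_) (sym (leftCover-decoy l j)) (x∈⁅x⁆ j)))))

  ∈-decoys⁻ : ∀ {j x} → x ∈ decoys j → j ∈ leftCover x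
  ∈-decoys⁻ {j} (Vec.there y∈) = lookup⇒[]= j _ (∈-tabulate⁻ _ y∈)

  -- Counts pairs of a hidden item `i` and a machine `j` that holds both it and the big item.
  collisions : Vec (Subset m) items → ℕ
  collisions a = ∑ λ i → ∑ λ j → weight (withBig i) (hits j) a

  -- Here `i` is the machine and `j` the left block of which it sees no decoy.
  absences : Vec (Subset m) items → ℕ
  absences a = ∑ λ i → ∑ λ j → weight (decoys j) (misses i) a

  -- The interface through which the analysis treats Greedy and local search alike.
  Admissible : (Subset items → Subset items) → Set
  Admissible alg = (∀ T → alg T ⊆ T) × (∀ T → zero ∉ T → Full T → NoHidden (alg T))

  admissible : ∀ {alg} →
    (∀ T → IsGreedyOutput cover K T (alg T)) ⊎ (∀ T → IsLocalOpt cover K T (alg T)) → Admissible alg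
  admissible (inj₁ greedy) =
    (λ T → greedy⊆ (greedy T) ⊥⊆) ,
    (λ T 0∉T full → greedy-noHidden (greedy T) 0∉T full ⊥⊆ (λ _ → ∉⊥))
  admissible (inj₂ local) = (λ T → proj₁ (local T)) , (λ T → localOpt-noHidden (local T))

  selected : (Subset items → Subset items) → Vec (Subset m) items → Subset items
  selected alg a = ⋃ (toList (tabulate (λ i → alg (machineInput a i))))

  -- An outcome with an absence is charged all points. Otherwise every machine is `Full`, and the
  -- value is at most that of all left blocks plus `K` for each surviving hidden item, which is
  -- charged to a collision.
  coreValue-bound : ∀ {alg} → Admissible alg → (a : Vec (Subset m) items) →
    coreValue cover K alg a ≤ K * suc K + (K * collisions a + points * absences a)
  coreValue-bound {m} {alg} (alg⊆ , noHidden) a with absences a in eq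
  ... | suc z = begin
    coreValue cover K alg a ≤⟨ fk≤cov cover K (selected alg a) ⟩
    cov cover (selected alg a)         ≤⟨ ∣p∣≤n (covered cover (selected alg a)) ⟩
    points                  ≤⟨ m≤m*n points (suc z) ⟩
    points * suc z          ≤⟨ m≤n+m _ (K * collisions a) ⟩
    K * collisions a + points * suc z ≤⟨ m≤n+m _ (K * suc K) ⟩
    K * suc K + (K * collisions a + points * suc z) ∎
    where open ≤-Reasoning
  ... | zero = begin
    coreValue cover K alg a                            ≤⟨ fk≤cov cover K S ⟩
    cov cover S                                        ≡⟨ cov-cover S ⟩
    cov leftCover S * suc K + cov rightCover S * K     ≤⟨ +-mono-≤ (*-monoˡ-≤ (suc K) (∣p∣≤n (covered leftCover S)))
                                                                  (*-monoˡ-≤ K (card≤∑ (covered rightCover S) _ collide)) ⟩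
    K * suc K + collisions a * K                       ≡⟨ cong (K * suc K +_) (*-comm (collisions a) K) ⟩
    K * suc K + K * collisions a                       ≤⟨ +-monoʳ-≤ (K * suc K) (m≤m+n _ (points * 0)) ⟩
    K * suc K + (K * collisions a + points * 0)        ∎
    where
    open ≤-Reasoning
    S = selected alg a
    hits-pos : ∀ {i x} → x ∈ machineInput a i → 1 ≤ hits i (lookup a x)
    hits-pos {i} {x} x∈ rewrite ∈-tabulate⁻ (λ x → lookup (lookup a x) i) x∈ = ≤-refl
    full : ∀ i → Full (machineInput a i)
    full i j =
      let x , x∈ , misses≡0 = weight-zero (decoys j) (misses i) a (∑≡0⇒≡0 (λ j → weight (decoys j) (misses i) a) (∑≡0⇒≡0 _ eq i) j)
      in x , ∈-tabulate⁺ (λ x → lookup (lookup a x) i) (misses≡0⇒true (lookup a x) misses≡0) , ∈-decoys⁻ x∈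
      where
      misses≡0⇒true : ∀ M → misses i M ≡ 0 → lookup M i ≡ true
      misses≡0⇒true M misses≡0 with lookup M i
      ... | true  = refl
    collide : ∀ {i} → i ∈ covered rightCover S → 1 ≤ ∑ λ j → weight (withBig i) (hits j) a
    collide {i} i∈ with ∈-covered⁻ rightCover S i∈
    ... | x , x∈S , i∈x with refl ← ∈-rightCover⁻ x i∈x
                        with j , hi∈ ← ∈-⋃⁻ (λ j → alg (machineInput a j)) x∈S
                        -- Machine `j` returned the hidden item although it is `Full`, so it must
                        -- hold the big item: a collision.
                        with zero ∈? machineInput a j
    ... | no  0∉ = contradiction hi∈ (noHidden _ 0∉ (full j) i)
    ... | yes 0∈ = ≤-trans (weight-pos (withBig i) (hits j) a both) (∑-≤ (λ j → weight (withBig i) (hits j) a) j)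
      where
      both : ∀ {x} → x ∈ withBig i → 1 ≤ hits j (lookup a x)
      both Vec.here       = hits-pos 0∈
      both (Vec.there y∈) rewrite x∈⁅y⁆⇒x≡y (i ↑ˡ (L * K)) y∈ = hits-pos (alg⊆ _ hi∈)

  -- Expected numbers of collisions and absences, as totals over the `N` outcomes.

  module Expectation (d C : ℕ) (c : Fin items → ℕ) (bounds : ∀ x → 1 ≤ c x × c x ≤ C) where

    M N E-collisions E-absences : ℕ
    M = suc d
    N = length (assignments M c)
    E-collisions = sumOver collisions (assignments M c)
    E-absences   = sumOver absences (assignments M c)

    -- There are h·M pairs, each colliding with probability at most (C/M)²; one factor `M` cancels.
    collisions-bound : M * E-collisions ≤ h * (C * C * N)
    collisions-bound = *-cancelˡ-≤ M (begin
      M * (M * E-collisions)      ≡⟨ *-assoc M M _ ⟨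
      M * M * E-collisions        ≤⟨ *-sumOver-∑-≤ (M * M) (M * (C * C * N)) _ (assignments M c)
                                       (λ i → *-sumOver-∑-≤ (M * M) (C * C * N) _ (assignments M c) (pair i)) ⟩
      h * (M * (C * C * N))       ≡⟨ swap h M (C * C * N) ⟩
      M * (h * (C * C * N))       ∎)
      where
      open ≤-Reasoning
      swap : ∀ a b c → a * (b * c) ≡ b * (a * c)
      swap = solve-∀
      power : ∀ i a → a ^ ∣ withBig i ∣ ≡ a * a
      power i a = trans (cong (λ z → a ^ suc z) (∣⁅x⁆∣≡1 (i ↑ˡ (L * K)))) (cong (a *_) (*-identityʳ a))
      pair : ∀ i j → M * M * sumOver (weight (withBig i) (hits j)) (assignments M c) ≤ C * C * N
      pair i j = subst₂ (λ x y → x * sumOver (weight (withBig i) (hits j)) (assignments M c) ≤ y * N)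
        (power i M) (power i C) (weight-hits C c (proj₂ ∘ bounds) (withBig i) j)

    -- There are M·K pairs, each of probability at most M/(M + L), which is weakened to M/L.
    absences-bound : L * E-absences ≤ M * (K * (M * N))
    absences-bound =
      *-sumOver-∑-≤ L (K * (M * N)) _ (assignments M c) λ i →
      *-sumOver-∑-≤ L (M * N) _ (assignments M c) λ j →
      ≤-trans (*-monoˡ-≤ _ (≤-trans (L≤card-decoys j) (m≤n+m _ M)))
              (weight-misses d c (proj₁ ∘ bounds) (decoys j) i)

    totalValue-bound : ∀ {alg} → Admissible alg →
      totalValue M cover K c alg ≤ N * (K * suc K) + (K * E-collisions + points * E-absences)
    totalValue-bound {alg} adm = begin
      sumOver (coreValue cover K alg) as
        ≤⟨ sumOver-mono (coreValue-bound adm) as ⟩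
      sumOver (λ a → K * suc K + (K * collisions a + points * absences a)) as
        ≡⟨ sumOver-+ (const (K * suc K)) _ as ⟩
      sumOver (const (K * suc K)) as + sumOver (λ a → K * collisions a + points * absences a) as
        ≡⟨ cong₂ _+_ (sumOver-const (K * suc K) as) (sumOver-+ (λ a → K * collisions a) _ as) ⟩
      N * (K * suc K) + (sumOver (λ a → K * collisions a) as + sumOver (λ a → points * absences a) as)
        ≡⟨ cong (N * (K * suc K) +_) (cong₂ _+_ (sumOver-*ˡ K collisions as) (sumOver-*ˡ points absences as)) ⟩
      N * (K * suc K) + (K * E-collisions + points * E-absences) ∎
      where
      open ≤-Reasoning
      as = assignments M c

-- Choice of the number of decoys and the final ratio.

theorem3 : (p q : ℕ) → 0 < p → 0 < q →
    (k : ℕ) → 1 ≤ k →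
    (m C : ℕ) → 1 ≤ C → C ≤ m → 2 * q * (C * C) ≤ p * m →
    Σ ℕ λ n → Σ ℕ λ u → Σ (Cover n u) λ cv →
    0 < opt cv k ×
    ((c : Fin n → ℕ) → (∀ x → 1 ≤ c x × c x ≤ C) →
    (alg : Subset n → Subset n) →
    ((∀ T → IsGreedyOutput cv k T (alg T)) ⊎ (∀ T → IsLocalOpt cv k T (alg T))) →
    ExpectationBound m cv k c alg p q)
theorem3 p q _ _ (suc h) _ zero    zero () _ _
theorem3 p q _ _ k@(suc h) _ m@(suc d) C 1≤C C≤m small =
  items , points , cover , ≤-trans (s≤s z≤n) points≤opt , λ c bounds alg alg-ok → bound c bounds (admissible alg-ok)
  where
  -- Expected absences are at most km²/L, so this `L` makes them at most 1/(2k), costing at most k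
  -- of the 2k² points.
  open HardInstance h (2 * k * (k * (m * m)))
  bound : ∀ c → (∀ x → 1 ≤ c x × c x ≤ C) → ∀ {alg} → Admissible alg →
          ExpectationBound m cover k c alg p q
  bound c bounds {alg} adm = begin
    2 * k * q * totalValue m cover k c alg
      ≤⟨ *-monoʳ-≤ (2 * k * q) (totalValue-bound adm) ⟩
    2 * k * q * (N * (k * suc k) + (k * X + points * Y))
      ≡⟨ expand h q N X Y ⟩
    2 * k * k * q * suc k * N + k * k * (2 * q * X) + 2 * k * k * q * (2 * k * Y)
      ≤⟨ +-mono-≤ (+-monoʳ-≤ (2 * k * k * q * suc k * N) (*-monoʳ-≤ (k * k) X-bound))
                  (*-monoʳ-≤ (2 * k * k * q) Y-bound) ⟩
    2 * k * k * q * suc k * N + k * k * (h * (p * N)) + 2 * k * k * q * N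
      ≤⟨ m≤m+n _ _ ⟩
    -- The terms in `q` already match: the left blocks exceed half of the 2k² points by k and
    -- absences cost another k, together the share 1/k. The slack only fills up the terms in `p`.
    2 * k * k * q * suc k * N + k * k * (h * (p * N)) + 2 * k * k * q * N + k * k * p * N * (3 * h + 4)
      ≡⟨ collect h p q N ⟩
    (k * q + 2 * q + 2 * k * p) * points * N
      ≤⟨ *-monoˡ-≤ N (*-monoʳ-≤ (k * q + 2 * q + 2 * k * p) points≤opt) ⟩
    (k * q + 2 * q + 2 * k * p) * opt cover k * N ∎
    where
    open ≤-Reasoning
    open Expectation d C c bounds hiding (M) renaming (E-collisions to X; E-absences to Y)
    expand : ∀ h q N X Y → let k = suc h in
      2 * k * q * (N * (k * suc k) + (k * X + (k * suc k + h * k) * Y)) ≡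
      2 * k * k * q * suc k * N + k * k * (2 * q * X) + 2 * k * k * q * (2 * k * Y)
    expand = solve-∀
    collect : ∀ h p q N → let k = suc h in
      2 * k * k * q * suc k * N + k * k * (h * (p * N)) + 2 * k * k * q * N + k * k * p * N * (3 * h + 4) ≡
      (k * q + 2 * q + 2 * k * p) * (k * suc k + h * k) * N
    collect = solve-∀
    -- With ε = p/q, the hypothesis C²/m ≤ ε/2 bounds the expected number of collisions by hε/2.
    X-bound : 2 * q * X ≤ h * (p * N)
    X-bound = *-cancelˡ-≤ m (begin
      m * (2 * q * X)             ≡⟨ swap m (2 * q) X ⟩
      2 * q * (m * X)             ≤⟨ *-monoʳ-≤ (2 * q) collisions-bound ⟩
      2 * q * (h * (C * C * N))   ≡⟨ swap′ (2 * q) h (C * C) N ⟩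
      2 * q * (C * C) * (h * N)   ≤⟨ *-monoˡ-≤ (h * N) small ⟩
      p * m * (h * N)             ≡⟨ swap″ p m h N ⟩
      m * (h * (p * N))           ∎)
      where
      swap : ∀ a b c → a * (b * c) ≡ b * (a * c)
      swap = solve-∀
      swap′ : ∀ a b c d → a * (b * (c * d)) ≡ a * c * (b * d)
      swap′ = solve-∀
      swap″ : ∀ a b c d → a * b * (c * d) ≡ b * (c * (a * d))
      swap″ = solve-∀
    Y-bound : 2 * k * Y ≤ N
    Y-bound = *-cancelˡ-≤ (k * (m * m)) (begin
      k * (m * m) * (2 * k * Y)   ≡⟨ swap (k * (m * m)) (2 * k) Y ⟩
      2 * k * (k * (m * m)) * Y   ≤⟨ absences-bound ⟩
      m * (k * (m * N))           ≡⟨ swap′ m k N ⟩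
      k * (m * m) * N             ∎)
      where
      swap : ∀ a b c → a * (b * c) ≡ b * a * c
      swap = solve-∀
      swap′ : ∀ a b c → a * (b * (a * c)) ≡ b * (a * a) * c
      swap′ = solve-∀
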